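{- Let $G$ be a loopless graph. Then the neighbourhood-set system $(V(G),\mathcal{N}(G))$ of $G$ is a well-graded family if and only if $G$ is either a nonempty set of isolated vertices or a union of some disjoint half-graphs and a nonempty set of isolated vertices.
   Context: Graphs are finite, undirected, with nonempty vertex set and no multiple edges. For a vertex $v$ of $G$, $N_G(v)$ is the set of vertices adjacent to $v$, and $\mathcal{N}(G)=\{N_G(v):v\in V(G)\}$ (a set of subsets of $V(G)$, without multiplicities). An isolated vertex is a vertex of degree $0$. A set system $(X,\mathcal{F})$ is a finite set $X$ with a nonempty family $\mathcal{F}$ of distinct subsets of $X$. Its one-inclusion graph $G_{\mathcal{F}}$ has a vertex $v_A$ for each $A\in\mathcal{F}$, with an edge (directed from $v_A$ to $v_B$, labelled $b$) whenever $B=A\cup\{b\}$ for some $b\in X\setminus A$. The system is well-graded if for all $A,B\in\mathcal{F}$ the distance between $v_A$ and $v_B$ in the underlying undirected graph of $G_{\mathcal{F}}$ equals $|A\triangle B|$ (the distance being infinite if there is no path). The half-graph of order $n\ge 1$ is a bipartite graph with parts $\{a_1,\dots,a_n\}$ and $\{b_1,\dots,b_n\}$ such that either for all $1\le i,j\le n$, $a_i$ is adjacent to $b_j$ iff $i\le j$, or for all $1\le i,j\le n$, $a_i$ is adjacent to $b_j$ iff $i\ge j$. A "union of disjoint half-graphs and isolated vertices" is a disjoint union, with no edges between different pieces; the half-graphs may have different orders. -}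

module Defs where

open import Level using (0ℓ)
open import Data.Nat using (ℕ; zero; suc; NonZero)
import Data.Nat as ℕ
open import Data.Fin using (Fin; _≤_; _≥_)
open import Data.Fin.Properties using (any?)
open import Data.Fin.Subset using (Subset; _∉_; _∪_; _─_; ⁅_⁆; ∣_∣)
open import Data.Bool.Properties using () renaming (_≟_ to _≟ᵇ_)
open import Data.Vec using (tabulate)
open import Data.Vec.Properties using (≡-dec)
open import Data.Product using (Σ; ∃; ∃-syntax; _×_; _,_)
open import Data.Sum using (_⊎_; inj₁; inj₂)
open import Data.Sum.Relation.Binary.Pointwise using (Pointwise; ⊎-symmetric)
open import Data.Refinement using (Refinement; value)
open import Function using (_↔_; _⇔_; Inverse)
open import Relation.Binary using (Rel; Decidable; Symmetric; Irreflexive)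
open import Relation.Binary.Construct.Closure.Symmetric as Sym using (SymClosure)
open import Relation.Binary.PropositionalEquality using (_≡_; refl)
open import Relation.Nullary using (does; ¬_)
open import Relation.Unary using (Pred) renaming (Decidable to Decidable₁)

-- Undirected, without multiple edges; loops are allowed.
record Graph : Set₁ where
  field
    Vertex : Set
    Adj    : Rel Vertex 0ℓ
    sym    : Symmetric Adj

-- A finite graph with its n vertices enumerated as Fin n.
record FiniteGraph (n : ℕ) : Set₁ where
  field
    Adj  : Rel (Fin n) 0ℓ
    adj? : Decidable Adj
    sym  : Symmetric Adj

  graph : Graph
  graph = record { Vertex = Fin n ; Adj = Adj ; sym = sym }

  neighbourhood : Fin n → Subset n
  neighbourhood v = tabulate (λ w → does (adj? v w))

  Loopless : Set
  Loopless = Irreflexive _≡_ Adj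

module _ (G : Graph) where
  open Graph G

  data Walk : Vertex → Vertex → ℕ → Set where
    []  : ∀ {u} → Walk u u zero
    _∷_ : ∀ {u v w k} → Adj u v → Walk v w k → Walk u w (suc k)

  -- The distance between u and v is finite and equal to d; vertices in
  -- different components (infinite distance) satisfy this for no d.
  Distance : Vertex → Vertex → ℕ → Set
  Distance u v d = Walk u v d × (∀ {k} → Walk u v k → d ℕ.≤ k)

-- Families are predicates on subsets, so their members have no multiplicity.
record SetSystem (n : ℕ) : Set₁ where
  field
    Member   : Pred (Subset n) 0ℓ
    member?  : Decidable₁ Member
    nonempty : ∃ Member

_△_ : ∀ {n} → Subset n → Subset n → Subset n
A △ B = (A ─ B) ∪ (B ─ A)

module _ {n : ℕ} (𝓕 : SetSystem n) where
  open SetSystem 𝓕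

  -- The membership proof in a Refinement is irrelevant, so there is exactly
  -- one vertex for each member of the family.
  MemberSet : Set
  MemberSet = Refinement (Subset n) Member

  LabelledEdge : Fin n → Rel MemberSet 0ℓ
  LabelledEdge b A B = b ∉ value A × value B ≡ value A ∪ ⁅ b ⁆

  DirectedEdge : Rel MemberSet 0ℓ
  DirectedEdge A B = ∃[ b ] LabelledEdge b A B

  -- The underlying undirected graph.
  oneInclusionGraph : Graph
  oneInclusionGraph = record
    { Vertex = MemberSet
    ; Adj    = SymClosure DirectedEdge
    ; sym    = Sym.symmetric DirectedEdge
    }

  WellGraded : Set
  WellGraded = ∀ A B → Distance oneInclusionGraph A B ∣ value A △ value B ∣

neighbourhoodSystem : ∀ {n} .{{_ : NonZero n}} → FiniteGraph n → SetSystem n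
neighbourhoodSystem {suc _} G = record
  { Member   = λ A → ∃[ v ] A ≡ neighbourhood v
  ; member?  = λ A → any? (λ v → ≡-dec _≟ᵇ_ A (neighbourhood v))
  ; nonempty = neighbourhood Fin.zero , Fin.zero , refl
  }
  where open FiniteGraph G

record _≅_ (G H : Graph) : Set where
  private
    module G = Graph G
    module H = Graph H
  field
    bijection : G.Vertex ↔ H.Vertex
  open Inverse bijection using (to)
  field
    adjacency : ∀ u v → G.Adj u v ⇔ H.Adj (to u) (to v)

infixr 5 _⊎ᴳ_

_⊎ᴳ_ : Graph → Graph → Graph
G ⊎ᴳ H = record
  { Vertex = G.Vertex ⊎ H.Vertex
  ; Adj    = Pointwise G.Adj H.Adj
  ; sym    = ⊎-symmetric G.sym H.sym
  }
  where
  module G = Graph G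
  module H = Graph H

module _ {I : Set} (H : I → Graph) where
  open module H i = Graph (H i) using () renaming (Vertex to V; Adj to E)

  data WithinPiece : Rel (Σ I V) 0ℓ where
    within : ∀ {i x y} → E i x y → WithinPiece (i , x) (i , y)

  disjointUnion : Graph
  disjointUnion = record
    { Vertex = Σ I V
    ; Adj    = WithinPiece
    ; sym    = λ { (within {i} e) → within (Graph.sym (H i) e) }
    }

-- part (inj₁ i) and part (inj₂ j) are the vertices a_i and b_j.
record IsHalfGraph (m : ℕ) (H : Graph) : Set where
  open Graph H
  field
    {{order≥1}} : NonZero m
    parts       : (Fin m ⊎ Fin m) ↔ Vertex

  open Inverse parts using () renaming (to to part)
  field
    a-independent : ∀ i j → ¬ Adj (part (inj₁ i)) (part (inj₁ j))
    b-independent : ∀ i j → ¬ Adj (part (inj₂ i)) (part (inj₂ j))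
    halved        : (∀ i j → Adj (part (inj₁ i)) (part (inj₂ j)) ⇔ i ≤ j)
                  ⊎ (∀ i j → Adj (part (inj₁ i)) (part (inj₂ j)) ⇔ i ≥ j)

Isolated : (G : Graph) → Graph.Vertex G → Set
Isolated G v = ∀ w → ¬ Graph.Adj G v w

NonemptyIsolatedSet : Graph → Set
NonemptyIsolatedSet G = Graph.Vertex G × (∀ v → Isolated G v)

-- There is at least one half-graph: the case of none is NonemptyIsolatedSet.
-- The pieces are finite whenever G is, by the isomorphism.
HalfGraphsAndIsolatedSet : Graph → Set₁
HalfGraphsAndIsolatedSet G =
  ∃[ k ] NonZero k ×
  Σ (Fin k → Graph) λ H → (∀ i → ∃[ m ] IsHalfGraph m (H i)) ×
  Σ Graph λ J → NonemptyIsolatedSet J ×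
  G ≅ (disjointUnion H ⊎ᴳ J)

{-# OPTIONS --safe #-}
-- Both sides are equivalent to the existence of a peeling: every non-isolated v
-- has N(v) = N(parent v) ∪ {label v}, with label injective on non-isolated
-- vertices (together with an isolated vertex, for the half-graph side).
--
-- If the system is well-graded, fix a root r and let label v be the first element
-- flipped on a geodesic from N(v) to N(r).  Every non-isolated x separates some
-- N(v) from N(r), as N(x) omits x, so x is a label.  Choosing a vertex for each
-- label, and letting isolated vertices choose themselves, gives an injection of
-- V(G) into itself.  It is onto, so r is chosen: hence some vertex is isolated,
-- and when r is isolated the labels form a peeling.
--
-- Given a peeling, label u ∈ N(v) iff N(u) ⊆ N(v); as adjacency is symmetric,
-- u ⊑ label v iff v ⊑ label u, where ⊑ compares neighbourhoods.  Thus label is an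
-- order-reversing involution; down-sets being chains by peeling, up-sets are chains
-- as well, and the order is a disjoint union of chains permuted by label.  A chain is not
-- mapped to itself, since its maximum would carry a loop, and a chain together
-- with its image is a half-graph.
--
-- Conversely, in a half-graph label exchanges a_i and b_i, and a peeling yields a
-- path from N(u) to N(v): if N(u) ≠ N(v), then label u ∉ N(v) or label v ∉ N(u), so
-- replacing u or v by its parent brings the two sets closer.
module Submission where

open import Defs
open import Level using (0ℓ)
open import Data.Bool using (true; false)
open import Data.Empty as Empty using (⊥-elim)
open import Data.Fin as Fin using (Fin; zero; suc; toℕ; punchOut)
import Data.Fin.Properties as Fin
open import Data.Fin.Subset using (Subset; _∈_; _∉_; _∪_; ⁅_⁆; ∣_∣; ⊥)
import Data.Fin.Subset.Properties as Subset
open import Data.Irrelevant using ([_])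
open import Data.Nat as ℕ using (ℕ; zero; suc; NonZero; _+_; _≤_; _<_; z≤n; s≤s; s<s; z<s)
open import Data.Nat.Induction using (<-wellFounded; Acc; acc)
import Data.Nat.Properties as ℕ
open import Data.Product using (∃; ∃-syntax; _×_; _,_; proj₁; proj₂)
open import Data.Refinement using (_,_; value; value-injective)
open import Data.Sum.Relation.Binary.Pointwise using (inj₁; inj₂)
open import Data.Sum as Sum using (_⊎_; inj₁; inj₂)
import Data.Sum.Properties as Sum
open import Data.Vec using ([]; _∷_; here; there)
open import Data.Vec.Properties using ([]=⇒lookup; lookup⇒[]=; lookup∘tabulate)
open import Function using (_⇔_; _∘_; id; flip; mk⇔; Equivalence; Inverse; Injective; mk↔ₛ′)
open import Function.Construct.Identity using (↔-id)
open import Relation.Binary.Construct.Closure.Symmetric using (fwd; bwd)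
open import Relation.Binary.Definitions using (tri<; tri≈; tri>)
open import Relation.Binary.PropositionalEquality as ≡
  using (_≡_; _≢_; refl; cong; subst; subst₂)
open import Relation.Nullary using (¬_; Dec; yes; no; contradiction; ¬?; _×-dec_)
open import Relation.Nullary.Decidable using (dec-true; recompute)
open import Relation.Unary using (Pred) renaming (Decidable to Decidable₁)
open Equivalence using (to; from)

-- Symmetric differences and insertion of an element

△-comm : ∀ {n} (A B : Subset n) → A △ B ≡ B △ A
△-comm A B = Subset.∪-comm _ _

∣A△A∣≡0 : ∀ {n} (A : Subset n) → ∣ A △ A ∣ ≡ 0
∣A△A∣≡0 []          = refl
∣A△A∣≡0 (true ∷ A)  = ∣A△A∣≡0 A
∣A△A∣≡0 (false ∷ A) = ∣A△A∣≡0 A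

∣A△B∣≡0⇒A≡B : ∀ {n} (A B : Subset n) → ∣ A △ B ∣ ≡ 0 → A ≡ B
∣A△B∣≡0⇒A≡B []          []          _  = refl
∣A△B∣≡0⇒A≡B (true ∷ A)  (true ∷ B)  eq = cong (true ∷_) (∣A△B∣≡0⇒A≡B A B eq)
∣A△B∣≡0⇒A≡B (false ∷ A) (false ∷ B) eq = cong (false ∷_) (∣A△B∣≡0⇒A≡B A B eq)

∣A△B∣-insert-∈ : ∀ {n} (A B : Subset n) {x} → x ∉ A → x ∈ B →
                 ∣ A △ B ∣ ≡ suc ∣ (A ∪ ⁅ x ⁆) △ B ∣
∣A△B∣-insert-∈ (true ∷ A)  (b ∷ B)     {zero}  x∉A here        = contradiction here x∉A
∣A△B∣-insert-∈ (false ∷ A) (true ∷ B)  {zero}  x∉A here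
  rewrite Subset.∪-identityʳ A = refl
∣A△B∣-insert-∈ (true ∷ A)  (true ∷ B)  {suc x} x∉A (there x∈B) = ∣A△B∣-insert-∈ A B (x∉A ∘ there) x∈B
∣A△B∣-insert-∈ (true ∷ A)  (false ∷ B) {suc x} x∉A (there x∈B) = cong suc (∣A△B∣-insert-∈ A B (x∉A ∘ there) x∈B)
∣A△B∣-insert-∈ (false ∷ A) (true ∷ B)  {suc x} x∉A (there x∈B) = cong suc (∣A△B∣-insert-∈ A B (x∉A ∘ there) x∈B)
∣A△B∣-insert-∈ (false ∷ A) (false ∷ B) {suc x} x∉A (there x∈B) = ∣A△B∣-insert-∈ A B (x∉A ∘ there) x∈B

∣A△B∣-insert-∉ : ∀ {n} (A B : Subset n) {x} → x ∉ A → x ∉ B →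
                 ∣ (A ∪ ⁅ x ⁆) △ B ∣ ≡ suc ∣ A △ B ∣
∣A△B∣-insert-∉ (true ∷ A)  (b ∷ B)     {zero}  x∉A x∉B = contradiction here x∉A
∣A△B∣-insert-∉ (false ∷ A) (true ∷ B)  {zero}  x∉A x∉B = contradiction here x∉B
∣A△B∣-insert-∉ (false ∷ A) (false ∷ B) {zero}  x∉A x∉B
  rewrite Subset.∪-identityʳ A = refl
∣A△B∣-insert-∉ (true ∷ A)  (true ∷ B)  {suc x} x∉A x∉B = ∣A△B∣-insert-∉ A B (x∉A ∘ there) (x∉B ∘ there)
∣A△B∣-insert-∉ (true ∷ A)  (false ∷ B) {suc x} x∉A x∉B = cong suc (∣A△B∣-insert-∉ A B (x∉A ∘ there) (x∉B ∘ there))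
∣A△B∣-insert-∉ (false ∷ A) (true ∷ B)  {suc x} x∉A x∉B = cong suc (∣A△B∣-insert-∉ A B (x∉A ∘ there) (x∉B ∘ there))
∣A△B∣-insert-∉ (false ∷ A) (false ∷ B) {suc x} x∉A x∉B = ∣A△B∣-insert-∉ A B (x∉A ∘ there) (x∉B ∘ there)

∣A∪⁅x⁆∣ : ∀ {n} (A : Subset n) {x} → x ∉ A → ∣ A ∪ ⁅ x ⁆ ∣ ≡ suc ∣ A ∣
∣A∪⁅x⁆∣ (true ∷ A)  {zero}  x∉A = contradiction here x∉A
∣A∪⁅x⁆∣ (false ∷ A) {zero}  x∉A rewrite Subset.∪-identityʳ A = refl
∣A∪⁅x⁆∣ (true ∷ A)  {suc x} x∉A = cong suc (∣A∪⁅x⁆∣ A (x∉A ∘ there))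
∣A∪⁅x⁆∣ (false ∷ A) {suc x} x∉A = ∣A∪⁅x⁆∣ A (x∉A ∘ there)

-- Injections and enumerations of finite sets

injective⇒surjective : ∀ {n} {f : Fin n → Fin n} → Injective _≡_ _≡_ f → ∀ y → ∃[ x ] f x ≡ y
injective⇒surjective {suc n} {f} f-inj y with Fin.any? (λ x → f x Fin.≟ y)
... | yes found  = found
-- If `y` were missed, punching it out would inject `Fin (suc n)` into `Fin n`.
... | no missing = contradiction
  (λ {x} {x′} eq → f-inj (Fin.punchOut-injective (avoids x) (avoids x′) eq))
  (Fin.<⇒notInjective {f = λ x → punchOut (avoids x)} (ℕ.n<1+n n))
  where
  avoids : ∀ x → y ≢ f x
  avoids x y≡fx = missing (x , ≡.sym y≡fx)

-- Indexes the half-graphs and the isolated vertices by `Fin`. A dependent pair over `P` would count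
-- an element once for each proof of `P`.
record Enumeration {n} (P : Pred (Fin n) 0ℓ) : Set where
  field
    size      : ℕ
    element   : Fin size → Fin n
    injective : ∀ {i j} → element i ≡ element j → i ≡ j
    sound     : ∀ i → P (element i)
    complete  : ∀ v → P v → ∃[ i ] element i ≡ v

enumerate : ∀ {n} {P : Pred (Fin n) 0ℓ} → Decidable₁ P → Enumeration P
enumerate {zero} P? = record
  { size = 0 ; element = λ () ; injective = λ { {()} } ; sound = λ () ; complete = λ () }
enumerate {suc n} {P} P? with P? zero | enumerate (P? ∘ suc)
... | no ¬p | tail = record
  { size = size
  ; element = suc ∘ element
  ; injective = injective ∘ Fin.suc-injective
  ; sound = sound
  ; complete = λ { zero p → contradiction p ¬p
                 ; (suc v) p → let i , eq = complete v p in i , cong suc eq }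
  }
  where open Enumeration tail
... | yes p | tail = record
  { size = suc size
  ; element = λ { zero → zero ; (suc i) → suc (element i) }
  ; injective = λ { {zero} {zero} _ → refl
                  ; {suc i} {suc j} eq → cong suc (injective (Fin.suc-injective eq)) }
  ; sound = λ { zero → p ; (suc i) → sound i }
  ; complete = λ { zero _ → zero , refl
                 ; (suc v) q → let i , eq = complete v q in suc i , cong suc eq }
  }
  where open Enumeration tail

-- Covers and peelings

record Covers (G : Graph) (v u x : Graph.Vertex G) : Set where
  open Graph G
  field
    new   : ¬ Adj u x
    -- Stated through adjacency and not through `Subset`, so as to apply to graphs whose vertices
    -- are not enumerated, such as disjoint unions.
    cover : ∀ y → Adj v y ⇔ (Adj u y ⊎ y ≡ x)

  adds : Adj v x
  adds = from (cover x) (inj₂ refl)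

  keeps : ∀ {y} → Adj u y → Adj v y
  keeps = from (cover _) ∘ inj₁

record Peeling (G : Graph) : Set where
  open Graph G
  field
    -- The values at isolated vertices are arbitrary.
    label parent    : Vertex → Vertex
    peel            : ∀ v → Isolated G v ⊎ Covers G v (parent v) (label v)
    label-injective : ∀ {u v} → ¬ Isolated G u → ¬ Isolated G v → label u ≡ label v → u ≡ v

-- Peelings of half-graphs

-- Each row of `R` is a single diagonal entry or adds its diagonal entry to another row. Columns
-- index the opposite side, so the label of a vertex is its partner there.
PeelableOrder : ∀ {m} → (Fin m → Fin m → Set) → Set
PeelableOrder R = ∀ i → (∀ j → R i j ⇔ j ≡ i)
                      ⊎ ∃[ i′ ] (¬ R i′ i × (∀ j → R i j ⇔ (R i′ j ⊎ j ≡ i)))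

≤-peelable : ∀ {m} → PeelableOrder {m} Fin._≤_
≤-peelable {m} i with suc (toℕ i) ℕ.<? m
... | no last = inj₁ (λ j → mk⇔
  (λ i≤j → Fin.≤-antisym (ℕ.s≤s⁻¹ (ℕ.≤-trans (Fin.toℕ<n j) (ℕ.≮⇒≥ last))) i≤j)
  (ℕ.≤-reflexive ∘ cong toℕ ∘ ≡.sym))
... | yes 1+i<m = inj₂ (i′ , (λ i′≤i → ℕ.1+n≰n (subst (_≤ toℕ i) toℕ-i′ i′≤i)) , λ j → mk⇔ split (join j))
  where
  i′ = Fin.fromℕ< 1+i<m
  toℕ-i′ = Fin.toℕ-fromℕ< 1+i<m
  split : ∀ {j} → i Fin.≤ j → i′ Fin.≤ j ⊎ j ≡ i
  split i≤j with ℕ.m≤n⇒m<n∨m≡n i≤j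
  ... | inj₁ i<j = inj₁ (subst (_≤ _) (≡.sym toℕ-i′) i<j)
  ... | inj₂ i≡j = inj₂ (≡.sym (Fin.toℕ-injective i≡j))
  join : ∀ j → i′ Fin.≤ j ⊎ j ≡ i → i Fin.≤ j
  join j (inj₁ i′≤j) = ℕ.<⇒≤ (subst (_≤ toℕ j) toℕ-i′ i′≤j)
  join j (inj₂ refl) = ℕ.≤-refl

≥-peelable : ∀ {m} → PeelableOrder {m} Fin._≥_
≥-peelable zero = inj₁ (λ j → mk⇔ (λ j≤0 → Fin.toℕ-injective (ℕ.n≤0⇒n≡0 j≤0)) (λ { refl → z≤n }))
≥-peelable (suc i) = inj₂
  ( Fin.inject₁ i
  , (λ i<i → ℕ.1+n≰n (subst (suc (toℕ i) ≤_) (Fin.toℕ-inject₁ i) i<i))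
  , λ j → mk⇔ split (join j))
  where
  split : ∀ {j} → suc i Fin.≥ j → Fin.inject₁ i Fin.≥ j ⊎ j ≡ suc i
  split j≤1+i with ℕ.m≤n⇒m<n∨m≡n j≤1+i
  ... | inj₁ j≤i = inj₁ (subst (_ ≤_) (≡.sym (Fin.toℕ-inject₁ i)) (ℕ.s≤s⁻¹ j≤i))
  ... | inj₂ eq  = inj₂ (Fin.toℕ-injective eq)
  join : ∀ j → Fin.inject₁ i Fin.≥ j ⊎ j ≡ suc i → suc i Fin.≥ j
  join j (inj₁ j≤i)  = ℕ.m≤n⇒m≤1+n (subst (toℕ j ≤_) (Fin.toℕ-inject₁ i) j≤i)
  join j (inj₂ refl) = ℕ.≤-refl

-- A vertex with a single neighbour has no parent inside its half-graph, where every neighbourhood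
-- is nonempty. The first case leaves that parent to be found outside the piece.
PieceStep : (H : Graph) (v l : Graph.Vertex H) → Set
PieceStep H v l = (∀ w → Graph.Adj H v w ⇔ w ≡ l) ⊎ ∃[ u ] Covers H v u l

-- `f` and `g` stand for the two sides in either order, so that one argument serves the `a`- and the
-- `b`-vertices.
module _ {m} (H : Graph) (f g : Fin m → Graph.Vertex H) {R : Fin m → Fin m → Set} where
  open Graph H

  OnSide : Vertex → Set
  OnSide w = (∃[ j ] w ≡ f j) ⊎ (∃[ j ] w ≡ g j)

  side-step : (∀ w → OnSide w) → (∀ {i j} → g i ≡ g j → i ≡ j) → (∀ {i j} → f i ≢ g j) →
              (∀ i j → ¬ Adj (f i) (f j)) → (∀ i j → Adj (f i) (g j) ⇔ R i j) →
              PeelableOrder R → ∀ i → PieceStep H (f i) (g i)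
  side-step sides g-inj f≢g f-indep fg peelable i with peelable i
  ... | inj₁ only = inj₁ λ w → mk⇔ (only-neighbour (sides w)) λ { refl → from (fg i i) (from (only i) refl) }
    where
    only-neighbour : ∀ {w} → OnSide w → Adj (f i) w → w ≡ g i
    only-neighbour (inj₁ (j , refl)) e = contradiction e (f-indep i j)
    only-neighbour (inj₂ (j , refl)) e = cong g (to (only j) (to (fg i j) e))
  ... | inj₂ (i′ , ¬Ri′i , splits) = inj₂ (f i′ , record
    { new = ¬Ri′i ∘ to (fg i′ i) ; cover = λ w → mk⇔ (split (sides w)) (join (sides w)) })
    where
    split : ∀ {w} → OnSide w → Adj (f i) w → Adj (f i′) w ⊎ w ≡ g i
    split (inj₁ (j , refl)) e = contradiction e (f-indep i j)
    split (inj₂ (j , refl)) e = Sum.map (from (fg i′ j)) (cong g) (to (splits j) (to (fg i j) e))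
    join : ∀ {w} → OnSide w → Adj (f i′) w ⊎ w ≡ g i → Adj (f i) w
    join (inj₁ (j , refl)) (inj₁ e)  = contradiction e (f-indep i′ j)
    join (inj₁ (j , refl)) (inj₂ eq) = contradiction eq f≢g
    join (inj₂ (j , refl)) x         = from (fg i j) (from (splits j) (Sum.map (to (fg i′ j)) g-inj x))

record PiecePeeling (H : Graph) : Set where
  open Graph H
  field
    label            : Vertex → Vertex
    label-involutive : ∀ v → label (label v) ≡ v
    steps            : ∀ v → PieceStep H v (label v)

halfGraph⇒peeling : ∀ {m H} → IsHalfGraph m H → PiecePeeling H
halfGraph⇒peeling {m} {H} half = record
  { label            = part ∘ Sum.swap ∘ position
  ; label-involutive = λ v → ≡.trans
      (cong (part ∘ Sum.swap) (strictlyInverseʳ _))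
      (≡.trans (cong part (Sum.swap-involutive (position v))) (strictlyInverseˡ v))
  ; steps            = λ v →
      subst (λ w → PieceStep H w (part (Sum.swap (position v)))) (strictlyInverseˡ v) (steps (position v))
  }
  where
  open Graph H
  open IsHalfGraph half
  open Inverse parts using (strictlyInverseˡ; strictlyInverseʳ) renaming (to to part; from to position)

  part-injective : ∀ {s t} → part s ≡ part t → s ≡ t
  part-injective {s} {t} eq = ≡.trans (≡.sym (strictlyInverseʳ s)) (≡.trans (cong position eq) (strictlyInverseʳ t))

  a b : Fin m → Vertex
  a = part ∘ inj₁
  b = part ∘ inj₂

  sides : ∀ w → (∃[ j ] w ≡ a j) ⊎ (∃[ j ] w ≡ b j)
  sides w with position w | strictlyInverseˡ w
  ... | inj₁ j | eq = inj₁ (j , ≡.sym eq)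
  ... | inj₂ j | eq = inj₂ (j , ≡.sym eq)

  a≢b : ∀ {i j} → a i ≢ b j
  a≢b eq with () ← part-injective eq

  -- The `b`-side sees the converse relation, whence the two peelability assumptions.
  both : ∀ {R} → PeelableOrder R → PeelableOrder (flip R) →
         (∀ i j → Adj (a i) (b j) ⇔ R i j) → ∀ s → PieceStep H (part s) (part (Sum.swap s))
  both {R} peelR _ ab (inj₁ i) =
    side-step H a b {R} sides (Sum.inj₂-injective ∘ part-injective) a≢b a-independent ab peelR i
  both {R} _ peelR′ ab (inj₂ i) =
    side-step H b a {flip R} (Sum.swap ∘ sides) (Sum.inj₁-injective ∘ part-injective) (a≢b ∘ ≡.sym) b-independent
      (λ i j → mk⇔ (to (ab j i) ∘ sym) (sym ∘ from (ab j i))) peelR′ i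

  steps : ∀ s → PieceStep H (part s) (part (Sum.swap s))
  steps with halved
  ... | inj₁ ab = both ≤-peelable ≥-peelable ab
  ... | inj₂ ab = both ≥-peelable ≤-peelable ab

module _ {I : Set} {H : I → Graph} (pieces : ∀ i → PiecePeeling (H i))
         {J : Graph} (J-isolated : NonemptyIsolatedSet J) where
  private
    module Pieces i = PiecePeeling (pieces i)
    K = disjointUnion H ⊎ᴳ J
    z = proj₁ J-isolated

  union-label : Graph.Vertex K → Graph.Vertex K
  union-label (inj₁ (i , v)) = inj₁ (i , Pieces.label i v)
  union-label (inj₂ j)       = inj₂ j

  union-parent : Graph.Vertex K → Graph.Vertex K
  union-parent (inj₁ (i , v)) with Pieces.steps i v
  -- Removing the only neighbour leaves the empty neighbourhood, which is that of the isolated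
  -- vertex `z`.
  ... | inj₁ _       = inj₂ z
  ... | inj₂ (u , _) = inj₁ (i , u)
  union-parent (inj₂ j) = inj₂ j

  union-label-involutive : ∀ v → union-label (union-label v) ≡ v
  union-label-involutive (inj₁ (i , v)) = cong (λ w → inj₁ (i , w)) (Pieces.label-involutive i v)
  union-label-involutive (inj₂ j)       = refl

  union-peel : ∀ v → Isolated K v ⊎ Covers K v (union-parent v) (union-label v)
  union-peel (inj₂ j) = inj₁ λ { (inj₂ w) (inj₂ e) → proj₂ J-isolated j w e }
  union-peel (inj₁ (i , v)) with Pieces.steps i v
  ... | inj₁ only = inj₂ record
    { new   = λ ()
    ; cover = λ y → mk⇔
        (λ { (inj₁ (within e)) → inj₂ (cong (λ w → inj₁ (i , w)) (to (only _) e)) })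
        (λ { (inj₁ (inj₂ e)) → contradiction e (proj₂ J-isolated z _)
           ; (inj₂ refl) → inj₁ (within (from (only _) refl)) })
    }
  ... | inj₂ (u , c) = inj₂ record
    { new   = λ { (inj₁ (within e)) → Covers.new c e }
    ; cover = λ y → mk⇔
        (λ { (inj₁ (within e)) → Sum.map keep (cong (λ w → inj₁ (i , w))) (to (Covers.cover c _) e) })
        (λ { (inj₁ (inj₁ (within e))) → inj₁ (within (Covers.keeps c e))
           ; (inj₂ refl) → inj₁ (within (Covers.adds c)) })
    }
    where
    keep : ∀ {w} → Graph.Adj (H i) u w → Graph.Adj K (inj₁ (i , u)) (inj₁ (i , w))
    keep e = inj₁ (within e)

  union-peeling : Peeling K
  union-peeling = record
    { label           = union-label
    ; parent          = union-parent
    ; peel            = union-peel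
    ; label-injective = λ {u} {v} _ _ eq → ≡.trans (≡.sym (union-label-involutive u))
        (≡.trans (cong union-label eq) (union-label-involutive v))
    }

≅-peeling : ∀ {G K} → G ≅ K → Peeling K → Peeling G
≅-peeling {G} {K} iso P = record
  { label           = decode ∘ P.label ∘ encode
  ; parent          = decode ∘ P.parent ∘ encode
  ; peel            = λ v → Sum.map (λ v-iso w vw → v-iso _ (to (adjacency v w) vw)) (pull v) (P.peel (encode v))
  ; label-injective = λ u-act v-act eq → encode-injective
      (P.label-injective (push-active u-act) (push-active v-act) (decode-injective eq))
  }
  where
  module P = Peeling P
  module G = Graph G
  module K = Graph K
  open _≅_ iso
  open Inverse bijection using (strictlyInverseˡ; strictlyInverseʳ) renaming (to to encode; from to decode)

  encode-injective : ∀ {u v} → encode u ≡ encode v → u ≡ v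
  encode-injective eq = ≡.trans (≡.sym (strictlyInverseʳ _)) (≡.trans (cong decode eq) (strictlyInverseʳ _))

  decode-injective : ∀ {x y} → decode x ≡ decode y → x ≡ y
  decode-injective eq = ≡.trans (≡.sym (strictlyInverseˡ _)) (≡.trans (cong encode eq) (strictlyInverseˡ _))

  push-active : ∀ {v} → ¬ Isolated G v → ¬ Isolated K (encode v)
  push-active v-act iso-v = v-act λ w vw → iso-v _ (to (adjacency _ w) vw)

  decode-adj : ∀ {x v} → G.Adj (decode x) v ⇔ K.Adj x (encode v)
  decode-adj {x} {v} = mk⇔
    (subst (λ y → K.Adj y (encode v)) (strictlyInverseˡ x) ∘ to (adjacency _ v))
    (from (adjacency _ v) ∘ subst (λ y → K.Adj y (encode v)) (≡.sym (strictlyInverseˡ x)))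

  pull : ∀ v {p l} → Covers K (encode v) p l → Covers G v (decode p) (decode l)
  pull v {p} {l} c = record
    { new   = Covers.new c ∘ subst (K.Adj p) (strictlyInverseˡ l) ∘ to decode-adj
    ; cover = λ y → mk⇔
        (λ vy → Sum.map (from decode-adj) (λ eq → ≡.trans (≡.sym (strictlyInverseʳ y)) (cong decode eq))
          (to (Covers.cover c _) (to (adjacency v y) vy)))
        (λ uy → from (adjacency v y) (from (Covers.cover c _)
          (Sum.map (to decode-adj) (λ { refl → strictlyInverseˡ l }) uy)))
    }

edgeless-peeling : ∀ {G} → (∀ v → Isolated G v) → Peeling G
edgeless-peeling isolated = record
  { label           = id
  ; parent          = id
  ; peel            = inj₁ ∘ isolated
  ; label-injective = λ _ _ → id
  }

halfGraphs⇒peeling : ∀ {G} → HalfGraphsAndIsolatedSet G → Peeling G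
halfGraphs⇒peeling (_ , _ , H , halves , J , J-isolated , iso) =
  ≅-peeling iso (union-peeling (halfGraph⇒peeling ∘ proj₂ ∘ halves) J-isolated)

-- Neighbourhoods in a finite graph

module Finite {n} (G : FiniteGraph n) where
  open FiniteGraph G

  ∈⇒adj : ∀ {v w} → w ∈ neighbourhood v → Adj v w
  ∈⇒adj {v} {w} w∈N with adj? v w | ≡.trans (≡.sym (lookup∘tabulate _ w)) ([]=⇒lookup w∈N)
  ... | yes vw | _ = vw

  adj⇒∈ : ∀ {v w} → Adj v w → w ∈ neighbourhood v
  adj⇒∈ {v} {w} vw = lookup⇒[]= w _ (≡.trans (lookup∘tabulate _ w) (dec-true (adj? v w) vw))

  isolated? : Decidable₁ (Isolated graph)
  isolated? v = Fin.all? (¬? ∘ adj? v)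

  ¬isolated⇒adj : ∀ {v} → ¬ Isolated graph v → ∃[ w ] Adj v w
  ¬isolated⇒adj {v} ¬iso with Fin.any? (adj? v)
  ... | yes vw = vw
  ... | no ¬vw = contradiction (λ w vw → ¬vw (w , vw)) ¬iso

  adj⇒¬isolatedˡ : ∀ {v w} → Adj v w → ¬ Isolated graph v
  adj⇒¬isolatedˡ vw iso = iso _ vw

  adj⇒¬isolatedʳ : ∀ {v w} → Adj v w → ¬ Isolated graph w
  adj⇒¬isolatedʳ vw iso = iso _ (sym vw)

  infix 4 _⊑_
  _⊑_ : Fin n → Fin n → Set
  u ⊑ v = ∀ {y} → Adj u y → Adj v y

  ⊑-antisym⇒N≡ : ∀ {u v} → u ⊑ v → v ⊑ u → neighbourhood u ≡ neighbourhood v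
  ⊑-antisym⇒N≡ u⊑v v⊑u = Subset.⊆-antisym (adj⇒∈ ∘ u⊑v ∘ ∈⇒adj) (adj⇒∈ ∘ v⊑u ∘ ∈⇒adj)

  N≡⇒⊑ : ∀ {u v} → neighbourhood u ≡ neighbourhood v → u ⊑ v
  N≡⇒⊑ eq uy = ∈⇒adj (subst (_ ∈_) eq (adj⇒∈ uy))

  isolated-N≡ : ∀ {u v} → Isolated graph u → Isolated graph v → neighbourhood u ≡ neighbourhood v
  isolated-N≡ iu iv = ⊑-antisym⇒N≡ (⊥-elim ∘ iu _) (⊥-elim ∘ iv _)

  deg : Fin n → ℕ
  deg v = ∣ neighbourhood v ∣

  deg-mono : ∀ {u v} → u ⊑ v → deg u ≤ deg v
  deg-mono u⊑v = Subset.p⊆q⇒∣p∣≤∣q∣ (adj⇒∈ ∘ u⊑v ∘ ∈⇒adj)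

  module _ {v u x} (c : Covers graph v u x) where
    open Covers c

    covers⇒∉ : x ∉ neighbourhood u
    covers⇒∉ = new ∘ ∈⇒adj

    covers⇒N≡ : neighbourhood v ≡ neighbourhood u ∪ ⁅ x ⁆
    covers⇒N≡ = Subset.⊆-antisym
      (λ y∈ → Subset.x∈p∪q⁺ (Sum.map adj⇒∈ (λ { refl → Subset.x∈⁅x⁆ x }) (to (cover _) (∈⇒adj y∈))))
      (λ y∈ → adj⇒∈ (from (cover _) (Sum.map ∈⇒adj (Subset.x∈⁅y⁆⇒x≡y x) (Subset.x∈p∪q⁻ _ _ y∈))))

    covers⇒deg : deg v ≡ suc (deg u)
    covers⇒deg = ≡.trans (cong ∣_∣ covers⇒N≡) (∣A∪⁅x⁆∣ (neighbourhood u) covers⇒∉)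

  N≡⇒covers : ∀ {v u x} → x ∉ neighbourhood u → neighbourhood v ≡ neighbourhood u ∪ ⁅ x ⁆ →
              Covers graph v u x
  N≡⇒covers {x = x} x∉ eq = record
    { new   = x∉ ∘ adj⇒∈
    ; cover = λ y → mk⇔
        (λ vy → Sum.map ∈⇒adj (Subset.x∈⁅y⁆⇒x≡y x) (Subset.x∈p∪q⁻ _ _ (subst (y ∈_) eq (adj⇒∈ vy))))
        (λ uy → ∈⇒adj (subst (y ∈_) (≡.sym eq)
          (Subset.x∈p∪q⁺ (Sum.map adj⇒∈ (λ { refl → Subset.x∈⁅x⁆ x }) uy))))
    }

-- The neighbourhood order of a peeled graph

module Peeled {n} (G : FiniteGraph n) (P : Peeling (FiniteGraph.graph G)) where
  open FiniteGraph G
  open Peeling P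
  open Finite G

  Active : Fin n → Set
  Active v = ¬ Isolated graph v

  covers : ∀ {v} → Active v → Covers graph v (parent v) (label v)
  covers {v} v-act with peel v
  ... | inj₁ iso = contradiction iso v-act
  ... | inj₂ c   = c

  v~label : ∀ {v} → Active v → Adj v (label v)
  v~label = Covers.adds ∘ covers

  deg-parent : ∀ {v} → Active v → deg v ≡ suc (deg (parent v))
  deg-parent = covers⇒deg ∘ covers

  -- Descend from `v` through parents, whose neighbourhoods shrink. `label u` remains a neighbour
  -- until it is itself the label to be removed, and injectivity of labels then says that `u` has
  -- been reached.
  v~label⇒⊑ : ∀ {u v} → Active u → Adj v (label u) → u ⊑ v
  v~label⇒⊑ {u} u-act = go (<-wellFounded _)
    where
    go : ∀ {v} → Acc _<_ (deg v) → Adj v (label u) → u ⊑ v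
    go {v} (acc rs) vlu with to (Covers.cover (covers (adj⇒¬isolatedˡ vlu)) _) vlu
    ... | inj₂ lu≡lv rewrite label-injective u-act (adj⇒¬isolatedˡ vlu) lu≡lv = id
    ... | inj₁ pvlu  = Covers.keeps (covers (adj⇒¬isolatedˡ vlu)) ∘
      go (rs (ℕ.≤-reflexive (≡.sym (deg-parent (adj⇒¬isolatedˡ vlu))))) pvlu

  -- `label v` is a neighbour of `u`. If it differs from `label u`, it is a neighbour of `parent u`;
  -- then `v` lies below `parent u`, which thereby acquires the neighbour `label u`.
  ⊑-antisym : ∀ {u v} → Active u → Active v → u ⊑ v → v ⊑ u → u ≡ v
  ⊑-antisym {u} {v} u-act v-act u⊑v v⊑u
    with to (Covers.cover (covers u-act) _) (v⊑u (v~label v-act))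
  ... | inj₂ lv≡lu = ≡.sym (label-injective v-act u-act lv≡lu)
  ... | inj₁ pulv  = contradiction
    (v~label⇒⊑ v-act pulv (u⊑v (v~label u-act)))
    (Covers.new (covers u-act))

-- The one-inclusion graph of the neighbourhood system

module OneInclusion {m} (G : FiniteGraph (suc m)) where
  open FiniteGraph G
  open Finite G

  𝓕 : SetSystem (suc m)
  𝓕 = neighbourhoodSystem G

  Γ : Graph
  Γ = oneInclusionGraph 𝓕

  node : Fin (suc m) → MemberSet 𝓕
  node v = neighbourhood v , [ v , refl ]

  -- The membership proof is irrelevant, so the witness is recomputed from decidability.
  isNode : ∀ A → ∃[ v ] A ≡ node v
  isNode (A , [ p ]) = let v , eq = recompute (SetSystem.member? 𝓕 A) p in v , value-injective eq

  dist : Fin (suc m) → Fin (suc m) → ℕ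
  dist u v = ∣ neighbourhood u △ neighbourhood v ∣

  N≡⇒dist≡0 : ∀ {u v} → neighbourhood u ≡ neighbourhood v → dist u v ≡ 0
  N≡⇒dist≡0 {u} eq = ≡.trans (cong (λ A → ∣ neighbourhood u △ A ∣) (≡.sym eq)) (∣A△A∣≡0 (neighbourhood u))

  -- An edge flips a single element `b`; whether `b` lies in `B` decides the direction in which the
  -- symmetric difference changes.
  edge-∣△∣ : ∀ {A A′} B → Graph.Adj Γ A A′ → ∣ value A △ B ∣ ≤ suc ∣ value A′ △ B ∣
  edge-∣△∣ {A , _} {_ , _} B (fwd (b , b∉A , refl)) with b Subset.∈? B
  ... | yes b∈B = ℕ.≤-reflexive (∣A△B∣-insert-∈ A B b∉A b∈B)
  ... | no  b∉B = ℕ.m≤n⇒m≤1+n (ℕ.≤-trans (ℕ.n≤1+n _) (ℕ.≤-reflexive (≡.sym (∣A△B∣-insert-∉ A B b∉A b∉B))))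
  edge-∣△∣ {_ , _} {A′ , _} B (bwd (b , b∉A′ , refl)) with b Subset.∈? B
  ... | yes b∈B = ℕ.m≤n⇒m≤1+n (ℕ.≤-trans (ℕ.n≤1+n _) (ℕ.≤-reflexive (≡.sym (∣A△B∣-insert-∈ A′ B b∉A′ b∈B))))
  ... | no  b∉B = ℕ.≤-reflexive (∣A△B∣-insert-∉ A′ B b∉A′ b∉B)

  ∣△∣≤length : ∀ {A B k} → Walk Γ A B k → ∣ value A △ value B ∣ ≤ k
  ∣△∣≤length {A} []           = ℕ.≤-reflexive (∣A△A∣≡0 (value A))
  ∣△∣≤length {B = B} (e ∷ w) = ℕ.≤-trans (edge-∣△∣ (value B) e) (s≤s (∣△∣≤length w))

  _∷ʳ_ : ∀ {A B C k} → Walk Γ A B k → Graph.Adj Γ B C → Walk Γ A C (suc k)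
  []      ∷ʳ e = e ∷ []
  (f ∷ w) ∷ʳ e = f ∷ (w ∷ʳ e)

  covers⇒edge : ∀ {v u x} → Covers graph v u x → DirectedEdge 𝓕 (node u) (node v)
  covers⇒edge {x = x} c = x , covers⇒∉ c , covers⇒N≡ c

  module _ (P : Peeling graph) where
    open Peeling P
    open Peeled G P

    -- Each removed label lies outside the other neighbourhood, so every step lowers the distance by
    -- exactly one.
    geodesic : ∀ k u v → dist u v ≡ k → Walk Γ (node u) (node v) k
    geodesic zero u v eq = subst (λ A → Walk Γ (node u) A 0)
      (value-injective (∣A△B∣≡0⇒A≡B (neighbourhood u) (neighbourhood v) eq)) []
    geodesic (suc k) u v eq = split (isolated? u) (isolated? v)
      where
      peelˡ : Active u → ¬ Adj v (label u) → Walk Γ (node u) (node v) (suc k)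
      peelˡ u-act v≁lu = bwd (covers⇒edge c) ∷ geodesic k (parent u) v (ℕ.suc-injective (begin
        suc (dist (parent u) v)
          ≡⟨ ∣A△B∣-insert-∉ (neighbourhood (parent u)) (neighbourhood v) (covers⇒∉ c) (v≁lu ∘ ∈⇒adj) ⟨
        ∣ (neighbourhood (parent u) ∪ ⁅ label u ⁆) △ neighbourhood v ∣
          ≡⟨ cong (λ A → ∣ A △ neighbourhood v ∣) (covers⇒N≡ c) ⟨
        dist u v ≡⟨ eq ⟩
        suc k    ∎))
        where
        open ≡.≡-Reasoning
        c = covers u-act

      peelʳ : Active v → ¬ Adj u (label v) → Walk Γ (node u) (node v) (suc k)
      peelʳ v-act u≁lv = geodesic k u (parent v) (ℕ.suc-injective (begin
        suc (dist u (parent v))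
          ≡⟨ cong (suc ∘ ∣_∣) (△-comm (neighbourhood u) (neighbourhood (parent v))) ⟩
        suc (dist (parent v) u)
          ≡⟨ ∣A△B∣-insert-∉ (neighbourhood (parent v)) (neighbourhood u) (covers⇒∉ c) (u≁lv ∘ ∈⇒adj) ⟨
        ∣ (neighbourhood (parent v) ∪ ⁅ label v ⁆) △ neighbourhood u ∣
          ≡⟨ cong (λ A → ∣ A △ neighbourhood u ∣) (covers⇒N≡ c) ⟨
        dist v u ≡⟨ cong ∣_∣ (△-comm (neighbourhood v) (neighbourhood u)) ⟩
        dist u v ≡⟨ eq ⟩
        suc k    ∎)) ∷ʳ fwd (covers⇒edge c)
        where
        open ≡.≡-Reasoning
        c = covers v-act

      N≢ : neighbourhood u ≢ neighbourhood v
      N≢ N≡ = ℕ.0≢1+n (≡.trans (≡.sym (N≡⇒dist≡0 N≡)) eq)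

      split : Dec (Isolated graph u) → Dec (Isolated graph v) → Walk Γ (node u) (node v) (suc k)
      split (yes u-iso) (yes v-iso) = contradiction (isolated-N≡ u-iso v-iso) N≢
      split (no u-act)  (yes v-iso) = peelˡ u-act (v-iso _)
      split (yes u-iso) (no v-act)  = peelʳ v-act (u-iso _)
      split (no u-act)  (no v-act) with adj? v (label u) | adj? u (label v)
      ... | no v≁lu | _       = peelˡ u-act v≁lu
      ... | yes _   | no u≁lv = peelʳ v-act u≁lv
      -- If neither label can be removed, each neighbourhood contains the other.
      ... | yes vlu | yes ulv = contradiction
        (⊑-antisym⇒N≡ (v~label⇒⊑ u-act vlu) (v~label⇒⊑ v-act ulv)) N≢

    peeling⇒wellGraded : WellGraded 𝓕
    peeling⇒wellGraded A B with isNode A | isNode B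
    ... | u , refl | v , refl = geodesic _ u v refl , ∣△∣≤length

  -- A peeling from a well-graded family

  module _ (wg : WellGraded 𝓕) (r : Fin (suc m)) where

    -- Take the first edge of a geodesic. The rest of the walk bounds the remaining distance, so the
    -- edge brings `v` exactly one closer; it may insert or delete its element.
    step : ∀ {v k} → dist v r ≡ suc k →
           ∃[ u ] ∃[ x ] dist v r ≡ suc (dist u r) × (Covers graph v u x ⊎ Covers graph u v x)
    step {v} {k} eq with subst (λ j → Walk Γ (node v) (node r) j) eq (proj₁ (wg (node v) (node r)))
    ... | _∷_ {v = A} e w with isNode A
    ... | u , refl = u , proj₁ (label e)
                   , ℕ.≤-antisym (edge-∣△∣ (neighbourhood r) e)
                       (ℕ.≤-trans (s≤s (∣△∣≤length w)) (ℕ.≤-reflexive (≡.sym eq)))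
                   , proj₂ (label e)
      where
      label : Graph.Adj Γ (node v) (node u) → ∃[ x ] (Covers graph v u x ⊎ Covers graph u v x)
      label (fwd (x , x∉ , N≡)) = x , inj₂ (N≡⇒covers x∉ N≡)
      label (bwd (x , x∉ , N≡)) = x , inj₁ (N≡⇒covers x∉ N≡)

    record Toward (v : Fin (suc m)) : Set where
      field
        next label : Fin (suc m)
        progress   : dist v r ≡ 0
                   ⊎ dist v r ≡ suc (dist next r) × (Covers graph v next label ⊎ Covers graph next v label)

    toward : ∀ v → Toward v
    toward v with dist v r in eq
    -- The geodesic has no edge here, and `v` fills both fields as a default.
    ... | zero  = record { next = v ; label = v ; progress = inj₁ eq }
    ... | suc _ = let u , x , p = step eq in record { next = u ; label = x ; progress = inj₂ p }

    open module T v = Toward (toward v)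

    Separates : Fin (suc m) → Fin (suc m) → Set
    Separates x v = (Adj v x × ¬ Adj r x) ⊎ (¬ Adj v x × Adj r x)

    -- The first edge changes adjacency at `label v` only.
    separates-next : ∀ {x v} → Covers graph v (next v) (label v) ⊎ Covers graph (next v) v (label v) →
                     label v ≢ x → Separates x v → Separates x (next v)
    separates-next (inj₁ c) lv≢x (inj₂ (v≁x , rx)) = inj₂ (v≁x ∘ Covers.keeps c , rx)
    separates-next (inj₂ c) lv≢x (inj₁ (vx , r≁x)) = inj₁ (Covers.keeps c vx , r≁x)
    separates-next (inj₁ c) lv≢x (inj₁ (vx , r≁x)) with to (Covers.cover c _) vx
    ... | inj₁ px   = inj₁ (px , r≁x)
    ... | inj₂ refl = contradiction refl lv≢x
    separates-next {x} {v} (inj₂ c) lv≢x (inj₂ (v≁x , rx)) = inj₂ (next≁x , rx)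
      where
      next≁x : ¬ Adj (next v) x
      next≁x px with to (Covers.cover c _) px
      ... | inj₁ vx   = v≁x vx
      ... | inj₂ refl = lv≢x refl

    -- Nothing separates the root from itself, so `x` has to be flipped somewhere along the way to
    -- the root.
    separated⇒label : ∀ {x v} → Acc _<_ (dist v r) → Separates x v → ∃[ u ] dist u r ≢ 0 × label u ≡ x
    separated⇒label {x} {v} (acc rs) sep with progress v | label v Fin.≟ x
    ... | inj₁ d≡0 | _ = contradiction sep λ where
      (inj₁ (vx , r≁x)) → r≁x (N≡⇒⊑ (∣A△B∣≡0⇒A≡B (neighbourhood v) (neighbourhood r) d≡0) vx)
      (inj₂ (v≁x , rx)) → v≁x (N≡⇒⊑ (≡.sym (∣A△B∣≡0⇒A≡B (neighbourhood v) (neighbourhood r) d≡0)) rx)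
    ... | inj₂ (d≡ , _) | yes lv≡x = v , (λ d≡0 → ℕ.1+n≢0 (≡.trans (≡.sym d≡) d≡0)) , lv≡x
    ... | inj₂ (d≡ , c) | no  lv≢x =
      separated⇒label (rs (ℕ.≤-reflexive (≡.sym d≡))) (separates-next c lv≢x sep)

    -- The assumption on isolated vertices holds for an isolated root, and vacuously for any root if
    -- no vertex is isolated.
    module _ (loopless : Loopless) (isolated⇒dist≡0 : ∀ {v} → Isolated graph v → dist v r ≡ 0) where

      -- If `x` is adjacent to the root, `x` separates itself from the root by looplessness;
      -- otherwise it separates any of its neighbours from the root.
      label-surjective : ∀ {x} → ¬ Isolated graph x → ∃[ v ] dist v r ≢ 0 × label v ≡ x
      label-surjective {x} x-act with adj? r x | ¬isolated⇒adj x-act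
      ... | yes rx | _      = separated⇒label (<-wellFounded _) (inj₂ (loopless refl , rx))
      ... | no r≁x | v , xv = separated⇒label (<-wellFounded _) (inj₁ (sym xv , r≁x))

      data Section (x v : Fin (suc m)) : Set where
        fixed : Isolated graph x → v ≡ x → Section x v
        moved : dist v r ≢ 0 → label v ≡ x → Section x v

      section : ∀ x → ∃ (Section x)
      section x with isolated? x
      ... | yes x-iso = x , fixed x-iso refl
      ... | no  x-act = let v , d≢0 , lv≡x = label-surjective x-act in v , moved d≢0 lv≡x

      -- Moved choices are told apart by their labels. A fixed choice is isolated, hence at distance
      -- zero, where no moved choice lies.
      section-injective : Injective _≡_ _≡_ (proj₁ ∘ section)
      section-injective {x} {y} = helper (proj₂ (section x)) (proj₂ (section y))
        where
        helper : ∀ {u v} → Section x u → Section y v → u ≡ v → x ≡ y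
        helper (fixed _ refl)     (fixed _ refl)     refl = refl
        helper (moved _ refl)     (moved _ refl)     refl = refl
        helper (fixed x-iso refl) (moved d≢0 _)      refl = contradiction (isolated⇒dist≡0 x-iso) d≢0
        helper (moved d≢0 _)      (fixed y-iso refl) refl = contradiction (isolated⇒dist≡0 y-iso) d≢0

      section-of : ∀ v → ∃[ x ] Section x v
      section-of v with injective⇒surjective section-injective v
      ... | x , refl = x , proj₂ (section x)

      -- The root is chosen for some vertex, and at distance zero it cannot be a moved choice.
      root-isolated : Isolated graph r
      root-isolated with section-of r
      ... | _ , fixed r-iso refl = r-iso
      ... | _ , moved d≢0 _      = contradiction (N≡⇒dist≡0 {r} refl) d≢0

      wellGraded⇒peeling : Peeling graph
      wellGraded⇒peeling = record
        { label           = label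
        ; parent          = next
        ; peel            = peel
        ; label-injective = label-inj
        }
        where
        peel : ∀ v → Isolated graph v ⊎ Covers graph v (next v) (label v)
        peel v with progress v
        ... | inj₁ d≡0           = inj₁ (λ w → root-isolated w ∘ N≡⇒⊑ (∣A△B∣≡0⇒A≡B (neighbourhood v) (neighbourhood r) d≡0))
        ... | inj₂ (_ , inj₁ c)  = inj₂ c
        -- Inserting an element moves away from the empty neighbourhood of the root.
        ... | inj₂ (d≡ , inj₂ c) = contradiction (ℕ.<-trans (ℕ.≤-reflexive (≡.sym d≡′)) (ℕ.≤-reflexive (≡.sym d≡)))
          (ℕ.<-irrefl refl)
          where
          d≡′ : dist (next v) r ≡ suc (dist v r)
          d≡′ = ≡.trans (cong (λ A → ∣ A △ neighbourhood r ∣) (covers⇒N≡ c))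
                  (∣A△B∣-insert-∉ (neighbourhood v) (neighbourhood r) (covers⇒∉ c) (root-isolated _ ∘ ∈⇒adj))

        label-inj : ∀ {u v} → ¬ Isolated graph u → ¬ Isolated graph v → label u ≡ label v → u ≡ v
        -- As the choice is onto, every non-isolated vertex is the one chosen for its own label.
        label-inj {u} {v} u-act v-act lu≡lv
          with injective⇒surjective section-injective u | injective⇒surjective section-injective v
        ... | x , refl | y , refl with proj₂ (section x) | proj₂ (section y)
        ... | fixed x-iso eq | _ = contradiction (subst (Isolated graph) (≡.sym eq) x-iso) u-act
        ... | _ | fixed y-iso eq = contradiction (subst (Isolated graph) (≡.sym eq) y-iso) v-act
        ... | moved _ lu≡x | moved _ lv≡y =
          cong (proj₁ ∘ section) (≡.trans (≡.sym lu≡x) (≡.trans lu≡lv lv≡y))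

  wellGraded⇒peeling×isolated : Loopless → WellGraded 𝓕 → Peeling graph × ∃ (Isolated graph)
  wellGraded⇒peeling×isolated loopless wg with Fin.any? isolated?
  ... | yes (r , r-iso) = wellGraded⇒peeling wg r loopless zero-dist , r , r-iso
    where
    zero-dist : ∀ {v} → Isolated graph v → dist v r ≡ 0
    zero-dist v-iso = N≡⇒dist≡0 (isolated-N≡ v-iso r-iso)
  -- Any root serves here, and it turns out to be isolated after all.
  ... | no none = contradiction
    (zero , root-isolated wg zero loopless (λ {v} v-iso → contradiction (v , v-iso) none)) none

-- Half-graphs from a peeling

data HalfEdge {m} : Fin m ⊎ Fin m → Fin m ⊎ Fin m → Set where
  ab : ∀ {i j} → i Fin.≤ j → HalfEdge (inj₁ i) (inj₂ j)
  ba : ∀ {i j} → i Fin.≤ j → HalfEdge (inj₂ j) (inj₁ i)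

halfGraph : ℕ → Graph
halfGraph m = record
  { Vertex = Fin m ⊎ Fin m
  ; Adj    = HalfEdge
  ; sym    = λ { (ab i≤j) → ba i≤j ; (ba i≤j) → ab i≤j }
  }

halfGraph-isHalfGraph : ∀ m .{{_ : NonZero m}} → IsHalfGraph m (halfGraph m)
halfGraph-isHalfGraph (suc _) = record
  { parts         = ↔-id _
  ; a-independent = λ _ _ ()
  ; b-independent = λ _ _ ()
  ; halved        = inj₁ (λ _ _ → mk⇔ (λ { (ab i≤j) → i≤j }) ab)
  }

emptyGraph : Set → Graph
emptyGraph V = record { Vertex = V ; Adj = λ _ _ → Empty.⊥ ; sym = λ () }

-- Chains of the neighbourhood order

module Decomposition {n} (G : FiniteGraph n) (loopless : FiniteGraph.Loopless G)
                     (P : Peeling (FiniteGraph.graph G)) where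
  open FiniteGraph G
  open Finite G
  open Peeling P renaming (label to σ)
  open Peeled G P

  σ-active : ∀ {v} → Active v → Active (σ v)
  σ-active = adj⇒¬isolatedʳ ∘ v~label

  ⊑⇒v~σ : ∀ {u v} → Active u → u ⊑ v → Adj v (σ u)
  ⊑⇒v~σ u-act u⊑v = u⊑v (v~label u-act)

  -- Both sides say that `σ u` and `σ v` are adjacent.
  galois : ∀ {u v} → Active u → Active v → u ⊑ σ v → v ⊑ σ u
  galois u-act v-act u⊑σv = v~label⇒⊑ v-act (sym (⊑⇒v~σ u-act u⊑σv))

  v⊑σσv : ∀ {v} → Active v → v ⊑ σ (σ v)
  v⊑σσv v-act = galois (σ-active v-act) v-act id

  σ-antitone : ∀ {u v} → Active u → Active v → u ⊑ v → σ v ⊑ σ u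
  σ-antitone u-act v-act u⊑v = galois u-act (σ-active v-act) (v⊑σσv v-act ∘ u⊑v)

  -- If `σ v` is a neighbour of `u`, then `v` lies below `u` too; otherwise removing `σ v` from the
  -- neighbours of `v` keeps those of `u`.
  ⊑⇒≡⊎⊑parent : ∀ {u v} → Active u → Active v → u ⊑ v → u ≡ v ⊎ u ⊑ parent v
  ⊑⇒≡⊎⊑parent {u} {v} u-act v-act u⊑v with adj? u (σ v)
  ... | yes uσv = inj₁ (⊑-antisym u-act v-act u⊑v (v~label⇒⊑ v-act uσv))
  ... | no u≁σv = inj₂ λ uy → Sum.[ id , (λ { refl → contradiction uy u≁σv }) ]
                                (to (Covers.cover (covers v-act) _) (u⊑v uy))

  ⊑⇒≡⊎deg< : ∀ {u v} → Active u → Active v → u ⊑ v → u ≡ v ⊎ deg u < deg v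
  ⊑⇒≡⊎deg< u-act v-act u⊑v with ⊑⇒≡⊎⊑parent u-act v-act u⊑v
  ... | inj₁ u≡v  = inj₁ u≡v
  ... | inj₂ u⊑pv = inj₂ (ℕ.≤-trans (s≤s (deg-mono u⊑pv)) (ℕ.≤-reflexive (≡.sym (deg-parent v-act))))

  -- σ ∘ σ is injective and inflationary, and degrees are at most n.
  σ-involutive : ∀ {v} → Active v → σ (σ v) ≡ v
  σ-involutive {v} = go n (ℕ.m≤m+n n (deg v))
    where
    go : ∀ f {v} → n ≤ f + deg v → Active v → σ (σ v) ≡ v
    go f {v} n≤ v-act with ⊑⇒≡⊎deg< v-act (σ-active (σ-active v-act)) (v⊑σσv v-act)
    ... | inj₁ v≡σσv = ≡.sym v≡σσv
    go zero {v} n≤ v-act | inj₂ lt = contradiction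
      (ℕ.≤-trans (s≤s n≤) (ℕ.≤-trans lt (Subset.∣p∣≤n (neighbourhood (σ (σ v))))))
      ℕ.1+n≰n
    go (suc f) {v} n≤ v-act | inj₂ lt =
      label-injective σσ-act v-act (label-injective (σ-active σσ-act) (σ-active v-act)
        (go f (ℕ.≤-trans n≤ (ℕ.≤-trans (ℕ.≤-reflexive (≡.sym (ℕ.+-suc f (deg v)))) (ℕ.+-monoʳ-≤ f lt))) σσ-act))
      where σσ-act = σ-active (σ-active v-act)

  isolated⇒deg≡0 : ∀ {v} → Isolated graph v → deg v ≡ 0
  isolated⇒deg≡0 {v} v-iso = ℕ.n≤0⇒n≡0 (ℕ.≤-trans
    (Subset.p⊆q⇒∣p∣≤∣q∣ {q = ⊥} (λ {w} w∈ → contradiction (∈⇒adj w∈) (v-iso w)))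
    (ℕ.≤-reflexive (Subset.∣⊥∣≡0 n)))

  deg>0⇒active : ∀ {v} → 0 < deg v → Active v
  deg>0⇒active 0<d v-iso = ℕ.<-irrefl (≡.sym (isolated⇒deg≡0 v-iso)) 0<d

  active⇒deg>0 : ∀ {v} → Active v → 0 < deg v
  active⇒deg>0 v-act = subst (0 <_) (≡.sym (deg-parent v-act)) z<s

  -- Meaningful for `j` up to `deg v`, where the neighbourhood becomes empty; beyond that, parents
  -- are arbitrary.
  ancestor : ℕ → Fin n → Fin n
  ancestor zero    v = v
  ancestor (suc j) v = ancestor j (parent v)

  module _ {j v} (j<d : suc j ≤ deg v) where
    private v-act = deg>0⇒active (ℕ.≤-trans z<s j<d)

    ≤deg-parent : j ≤ deg (parent v)
    ≤deg-parent = ℕ.s≤s⁻¹ (subst (suc j ≤_) (deg-parent v-act) j<d)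

    parent-⊑ : parent v ⊑ v
    parent-⊑ = Covers.keeps (covers v-act)

  deg-ancestor : ∀ {j v} → j ≤ deg v → deg (ancestor j v) + j ≡ deg v
  deg-ancestor {zero}      _   = ℕ.+-identityʳ _
  deg-ancestor {suc j} {v} j<d = ≡.trans (ℕ.+-suc _ j) (≡.trans
    (cong suc (deg-ancestor (≤deg-parent j<d)))
    (≡.sym (deg-parent (deg>0⇒active (ℕ.≤-trans z<s j<d)))))

  ancestor-antitone : ∀ {i j v} → i ≤ j → j ≤ deg v → ancestor j v ⊑ ancestor i v
  ancestor-antitone {j = zero}  z≤n       _   = id
  ancestor-antitone {j = suc j} z≤n       j<d = parent-⊑ j<d ∘ ancestor-antitone {j = j} z≤n (≤deg-parent j<d)
  ancestor-antitone             (s≤s i≤j) j<d = ancestor-antitone i≤j (≤deg-parent j<d)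

  ancestor-⊑ : ∀ {j v} → j ≤ deg v → ancestor j v ⊑ v
  ancestor-⊑ = ancestor-antitone z≤n

  ancestor-active : ∀ {j v} → j < deg v → Active (ancestor j v)
  ancestor-active {j} {v} j<d = deg>0⇒active (ℕ.+-cancelʳ-< j 0 _
    (subst (j <_) (≡.sym (deg-ancestor (ℕ.<⇒≤ j<d))) j<d))

  -- Each generation loses one neighbour, so comparing degrees compares indices.
  ancestor-cancel-≤ : ∀ {i j v} → i < deg v → j < deg v → ancestor j v ⊑ ancestor i v → i ≤ j
  ancestor-cancel-≤ {i} {j} {v} i<d j<d below = ℕ.+-cancelˡ-≤ (deg (ancestor j v)) _ _ (begin
    deg (ancestor j v) + i ≤⟨ ℕ.+-monoˡ-≤ i (deg-mono below) ⟩
    deg (ancestor i v) + i ≡⟨ deg-ancestor (ℕ.<⇒≤ i<d) ⟩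
    deg v                  ≡⟨ deg-ancestor (ℕ.<⇒≤ j<d) ⟨
    deg (ancestor j v) + j ∎)
    where open ℕ.≤-Reasoning

  ⊑⇒ancestor : ∀ {u v} → Active u → Active v → u ⊑ v → ∃[ j ] j < deg v × ancestor j v ≡ u
  ⊑⇒ancestor {u} u-act = go (<-wellFounded _)
    where
    go : ∀ {v} → Acc _<_ (deg v) → Active v → u ⊑ v → ∃[ j ] j < deg v × ancestor j v ≡ u
    go (acc rs) v-act u⊑v with ⊑⇒≡⊎⊑parent u-act v-act u⊑v
    ... | inj₁ refl = 0 , active⇒deg>0 v-act , refl
    ... | inj₂ u⊑pv =
      let j , j<d , eq = go (rs (ℕ.≤-reflexive (≡.sym (deg-parent v-act))))
                            (adj⇒¬isolatedˡ (⊑⇒v~σ u-act u⊑pv)) u⊑pv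
      in suc j , subst (suc j <_) (≡.sym (deg-parent v-act)) (s<s j<d) , eq

  -- For active `v`, the last ancestor before the neighbourhood becomes empty: the minimum of the
  -- chain below `v`.
  bottom : Fin n → Fin n
  bottom v = ancestor (ℕ.pred (deg v)) v

  module _ {v} (v-act : Active v) where
    private
      pred-deg : suc (ℕ.pred (deg v)) ≡ deg v
      pred-deg = ℕ.suc-pred (deg v) {{ℕ.>-nonZero (active⇒deg>0 v-act)}}

    bottom-active : Active (bottom v)
    bottom-active = ancestor-active (ℕ.≤-reflexive pred-deg)

    bottom-⊑ : bottom v ⊑ v
    bottom-⊑ = ancestor-⊑ (ℕ.pred[n]≤n {deg v})

    deg-bottom : deg (bottom v) ≡ 1
    deg-bottom = ℕ.+-cancelʳ-≡ (ℕ.pred (deg v)) _ 1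
      (≡.trans (deg-ancestor (ℕ.pred[n]≤n {deg v})) (≡.sym pred-deg))

    bottom-unique : ∀ {u} → Active u → deg u ≡ 1 → u ⊑ v → u ≡ bottom v
    bottom-unique u-act d≡1 u⊑v with ⊑⇒ancestor u-act v-act u⊑v
    ... | j , j<d , refl = cong (λ i → ancestor i v) (cong ℕ.pred
      (≡.trans (cong (_+ j) (≡.sym d≡1)) (deg-ancestor (ℕ.<⇒≤ j<d))))

  -- As `σ` reverses the order, the maximum above `v` is the image of the minimum below `σ v`.
  -- Maximality of `t` is expressed by `deg (σ t) ≡ 1`.
  top : Fin n → Fin n
  top v = σ (bottom (σ v))

  module _ {v} (v-act : Active v) where
    private bottom-act = bottom-active (σ-active v-act)

    top-active : Active (top v)
    top-active = σ-active bottom-act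

    ⊑-top : v ⊑ top v
    ⊑-top = galois bottom-act v-act (bottom-⊑ (σ-active v-act))

    deg-σ-top : deg (σ (top v)) ≡ 1
    deg-σ-top = ≡.trans (cong deg (σ-involutive bottom-act)) (deg-bottom (σ-active v-act))

    top-unique : ∀ {t} → Active t → deg (σ t) ≡ 1 → v ⊑ t → t ≡ top v
    top-unique t-act d≡1 v⊑t = ≡.trans (≡.sym (σ-involutive t-act)) (cong σ
      (bottom-unique (σ-active v-act) (σ-active t-act) d≡1 (σ-antitone v-act t-act v⊑t)))

  top-cong : ∀ {u v} → Active u → Active v → u ⊑ v → top u ≡ top v
  top-cong u-act v-act u⊑v =
    ≡.sym (top-unique u-act (top-active v-act) (deg-σ-top v-act) (⊑-top v-act ∘ u⊑v))

  top-σ-cong : ∀ {u v} → Active u → Active v → u ⊑ v → top (σ u) ≡ top (σ v)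
  top-σ-cong u-act v-act u⊑v =
    ≡.sym (top-cong (σ-active v-act) (σ-active u-act) (σ-antitone u-act v-act u⊑v))

  -- For a common top `t`, `σ t` lies below `σ v` and hence below `t`, so that `t` is adjacent to
  -- `σ (σ t)`, which is `t`.
  top-σ-≢ : ∀ {v} → Active v → top v ≢ top (σ v)
  top-σ-≢ {v} v-act eq = loopless refl
    (subst (Adj t) (σ-involutive t-act) (⊑⇒v~σ (σ-active t-act) σt⊑t))
    where
    t     = top v
    t-act = top-active v-act
    σt⊑t : σ t ⊑ t
    σt⊑t = subst (λ w → σ v ⊑ w) (≡.sym eq) (⊑-top (σ-active v-act))
         ∘ σ-antitone v-act t-act (⊑-top v-act)

  -- The a-side of a piece is the chain below its top t, the b-side the image of
  -- that chain under σ, whose top is top (σ t); the inequality selects one of the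
  -- two sides to be the a-side.
  Leading : Fin n → Set
  Leading t = Active t × deg (σ t) ≡ 1 × t Fin.< top (σ t)

  leading? : Decidable₁ Leading
  leading? t = ¬? (isolated? t) ×-dec (deg (σ t) ℕ.≟ 1) ×-dec (t Fin.<? top (σ t))

  -- The isomorphism with half-graphs and isolated vertices

  module _ (leaders : Enumeration Leading) (isolateds : Enumeration (Isolated graph)) where
    private
      module Pieces    = Enumeration leaders
      module Remainder = Enumeration isolateds

    apex : Fin Pieces.size → Fin n
    apex = Pieces.element

    order : Fin Pieces.size → ℕ
    order i = deg (apex i)

    apex-active : ∀ i → Active (apex i)
    apex-active i = proj₁ (Pieces.sound i)

    apex-order : ∀ i → deg (σ (apex i)) ≡ 1
    apex-order i = proj₁ (proj₂ (Pieces.sound i))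

    pieces : Fin Pieces.size → Graph
    pieces = halfGraph ∘ order

    remainder : Graph
    remainder = emptyGraph (Fin Remainder.size)

    K : Graph
    K = disjointUnion pieces ⊎ᴳ remainder

    -- Indices run down the chain from the apex, so a larger index means a smaller neighbourhood.
    a b : ∀ i → Fin (order i) → Fin n
    a i j = ancestor (toℕ j) (apex i)
    b i j = σ (a i j)

    vertex : Graph.Vertex K → Fin n
    vertex (inj₁ (i , inj₁ j)) = a i j
    vertex (inj₁ (i , inj₂ j)) = b i j
    vertex (inj₂ r)            = Remainder.element r

    a-active : ∀ i j → Active (a i j)
    a-active i j = ancestor-active (Fin.toℕ<n j)

    a-⊑ : ∀ i j → a i j ⊑ apex i
    a-⊑ i j = ancestor-⊑ (ℕ.<⇒≤ (Fin.toℕ<n j))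

    top-a : ∀ i j → top (a i j) ≡ apex i
    top-a i j = ≡.sym (top-unique (a-active i j) (apex-active i) (apex-order i) (a-⊑ i j))

    top-b : ∀ i j → top (b i j) ≡ top (σ (apex i))
    top-b i j = top-σ-cong (a-active i j) (apex-active i) (a-⊑ i j)

    σb≡a : ∀ i j → σ (b i j) ≡ a i j
    σb≡a i j = σ-involutive (a-active i j)

    -- An apex precedes the top of its opposite chain, so mutually opposite apices would precede
    -- each other.
    leading-clash : ∀ i i′ → top (σ (apex i)) ≡ apex i′ → ¬ (top (σ (apex i′)) ≡ apex i)
    leading-clash i i′ eq eq′ = ℕ.<-asym
      (subst (apex i Fin.<_) eq (proj₂ (proj₂ (Pieces.sound i))))
      (subst (apex i′ Fin.<_) eq′ (proj₂ (proj₂ (Pieces.sound i′))))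

    a≢b : ∀ i j i′ j′ → a i j ≢ b i′ j′
    a≢b i j i′ j′ eq = leading-clash i i′
      (≡.trans (≡.sym (top-b i j)) (≡.trans (cong top (≡.trans (cong σ eq) (σb≡a i′ j′))) (top-a i′ j′)))
      (≡.trans (≡.sym (top-b i′ j′)) (≡.trans (cong top (≡.sym eq)) (top-a i j)))

    -- Reading `a i j` as `σ (b i j)`, adjacency puts `b i j` below `a i′ j′`, which makes the two
    -- chains opposite; by symmetry they are mutually opposite.
    a≁a : ∀ i j i′ j′ → ¬ Adj (a i j) (a i′ j′)
    a≁a i j i′ j′ e = leading-clash i i′ (opposite i j i′ j′ e) (opposite i′ j′ i j (sym e))
      where
      opposite : ∀ i j i′ j′ → Adj (a i j) (a i′ j′) → top (σ (apex i)) ≡ apex i′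
      opposite i j i′ j′ e = ≡.trans (≡.sym (top-b i j)) (≡.trans
        (top-cong b-act (a-active i′ j′)
          (v~label⇒⊑ b-act (subst (Adj (a i′ j′)) (≡.sym (σb≡a i j)) (sym e))))
        (top-a i′ j′))
        where b-act = σ-active (a-active i j)

    b≁b : ∀ i j i′ j′ → ¬ Adj (b i j) (b i′ j′)
    b≁b i j i′ j′ e = leading-clash i i′ (opposite i j i′ j′ e) (opposite i′ j′ i j (sym e))
      where
      opposite : ∀ i j i′ j′ → Adj (b i j) (b i′ j′) → top (σ (apex i)) ≡ apex i′
      opposite i j i′ j′ e = ≡.trans (≡.sym (top-b i j)) (≡.trans
        (≡.sym (top-cong (a-active i′ j′) (σ-active (a-active i j)) (v~label⇒⊑ (a-active i′ j′) e)))
        (top-a i′ j′))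

    a~b⇒⊑ : ∀ i j i′ j′ → Adj (a i j) (b i′ j′) → a i′ j′ ⊑ a i j
    a~b⇒⊑ i j i′ j′ = v~label⇒⊑ (a-active i′ j′)

    -- Comparable vertices have the same top.
    ⊑⇒i≡i′ : ∀ i j i′ j′ → a i′ j′ ⊑ a i j → i ≡ i′
    ⊑⇒i≡i′ i j i′ j′ below = Pieces.injective
      (≡.trans (≡.sym (top-a i j)) (≡.trans (≡.sym (top-cong (a-active i′ j′) (a-active i j) below)) (top-a i′ j′)))

    a-cancel-≤ : ∀ i j j′ → a i j′ ⊑ a i j → j Fin.≤ j′
    a-cancel-≤ i j j′ = ancestor-cancel-≤ {toℕ j} {toℕ j′} {apex i} (Fin.toℕ<n j) (Fin.toℕ<n j′)

    a~b⇒edge : ∀ i j i′ j′ → Adj (a i j) (b i′ j′) →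
               Graph.Adj K (inj₁ (i , inj₁ j)) (inj₁ (i′ , inj₂ j′))
    a~b⇒edge i j i′ j′ e = same-piece (⊑⇒i≡i′ i j i′ j′ (a~b⇒⊑ i j i′ j′ e)) j′ e
      where
      same-piece : ∀ {i′} → i ≡ i′ → ∀ j′ → Adj (a i j) (b i′ j′) →
                   Graph.Adj K (inj₁ (i , inj₁ j)) (inj₁ (i′ , inj₂ j′))
      same-piece refl j′ e = inj₁ (within (ab (a-cancel-≤ i j j′ (a~b⇒⊑ i j i j′ e))))

    ≤⇒a~b : ∀ i j j′ → j Fin.≤ j′ → Adj (a i j) (b i j′)
    ≤⇒a~b i j j′ j≤j′ =
      ⊑⇒v~σ (a-active i j′) (ancestor-antitone {toℕ j} {toℕ j′} {apex i} j≤j′ (ℕ.<⇒≤ (Fin.toℕ<n j′)))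

    vertex-adj : ∀ x y → Adj (vertex x) (vertex y) ⇔ Graph.Adj K x y
    vertex-adj x y = mk⇔ (reflect x y) preserve
      where
      reflect : ∀ x y → Adj (vertex x) (vertex y) → Graph.Adj K x y
      reflect (inj₁ (i , inj₁ j)) (inj₁ (i′ , inj₁ j′)) e = contradiction e (a≁a i j i′ j′)
      reflect (inj₁ (i , inj₁ j)) (inj₁ (i′ , inj₂ j′)) e = a~b⇒edge i j i′ j′ e
      reflect (inj₁ (i , inj₂ j)) (inj₁ (i′ , inj₁ j′)) e = Graph.sym K (a~b⇒edge i′ j′ i j (sym e))
      reflect (inj₁ (i , inj₂ j)) (inj₁ (i′ , inj₂ j′)) e = contradiction e (b≁b i j i′ j′)
      reflect (inj₂ r) y e = contradiction e (Remainder.sound r (vertex y))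
      reflect x@(inj₁ _) (inj₂ r) e = contradiction (sym e) (Remainder.sound r (vertex x))

      preserve : ∀ {x y} → Graph.Adj K x y → Adj (vertex x) (vertex y)
      preserve (inj₁ (within (ab j≤j′))) = ≤⇒a~b _ _ _ j≤j′
      preserve (inj₁ (within (ba j≤j′))) = sym (≤⇒a~b _ _ _ j≤j′)

    a-injective : ∀ i j i′ j′ → a i j ≡ a i′ j′ → (i , j) ≡ (i′ , j′)
    a-injective i j i′ j′ eq = same-piece (⊑⇒i≡i′ i j i′ j′ (λ {y} → subst (λ v → Adj v y) (≡.sym eq))) j′ eq
      where
      same-piece : ∀ {i′} → i ≡ i′ → ∀ j′ → a i j ≡ a i′ j′ → (i , j) ≡ (i′ , j′)
      same-piece refl j′ eq = cong (i ,_) (Fin.≤-antisym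
        (a-cancel-≤ i j j′ (λ {y} → subst (λ v → Adj v y) (≡.sym eq)))
        (a-cancel-≤ i j′ j (λ {y} → subst (λ v → Adj v y) eq)))

    vertex-active : ∀ x → Active (vertex (inj₁ x))
    vertex-active (i , inj₁ j) = a-active i j
    vertex-active (i , inj₂ j) = σ-active (a-active i j)

    vertex-injective : ∀ x y → vertex x ≡ vertex y → x ≡ y
    vertex-injective (inj₁ (i , inj₁ j)) (inj₁ (i′ , inj₁ j′)) eq =
      cong (λ (i , j) → inj₁ (i , inj₁ j)) (a-injective i j i′ j′ eq)
    vertex-injective (inj₁ (i , inj₁ j)) (inj₁ (i′ , inj₂ j′)) eq = contradiction eq (a≢b i j i′ j′)
    vertex-injective (inj₁ (i , inj₂ j)) (inj₁ (i′ , inj₁ j′)) eq = contradiction (≡.sym eq) (a≢b i′ j′ i j)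
    vertex-injective (inj₁ (i , inj₂ j)) (inj₁ (i′ , inj₂ j′)) eq =
      cong (λ (i , j) → inj₁ (i , inj₂ j))
        (a-injective i j i′ j′ (label-injective (a-active i j) (a-active i′ j′) eq))
    vertex-injective (inj₁ x) (inj₂ r) eq =
      contradiction (subst (Isolated graph) (≡.sym eq) (Remainder.sound r)) (vertex-active x)
    vertex-injective (inj₂ r) (inj₁ y) eq =
      contradiction (subst (Isolated graph) eq (Remainder.sound r)) (vertex-active y)
    vertex-injective (inj₂ r) (inj₂ r′) eq = cong inj₂ (Remainder.injective eq)

    chain-surjective : ∀ {t v} → Leading t → Active v → v ⊑ t → ∃[ i ] ∃[ j ] a i j ≡ v
    chain-surjective {t} t-leads v-act v⊑t with Pieces.complete t t-leads
    ... | i , refl with ⊑⇒ancestor v-act (apex-active i) v⊑t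
    ... | j , j<d , eq = i , Fin.fromℕ< j<d , ≡.trans (cong (λ k → ancestor k (apex i)) (Fin.toℕ-fromℕ< j<d)) eq

    top-leads : ∀ {v} → Active v → top v Fin.< top (σ v) → Leading (top v)
    top-leads {v} v-act lt = top-active v-act , deg-σ-top v-act
      , subst (top v Fin.<_) (top-σ-cong v-act (top-active v-act) (⊑-top v-act)) lt

    -- For active `v` the tops of `v` and `σ v` differ, and the smaller one leads: `v` is on the
    -- `a`-side of its piece if that is `top v`, and on the `b`-side, as `σ (σ v)`, if not.
    vertex-surjective : ∀ v → ∃[ x ] vertex x ≡ v
    vertex-surjective v with isolated? v
    ... | yes v-iso = let r , eq = Remainder.complete v v-iso in inj₂ r , eq
    ... | no v-act with Fin.<-cmp (top v) (top (σ v))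
    ... | tri≈ _ eq _ = contradiction eq (top-σ-≢ v-act)
    ... | tri< lt _ _ =
      let i , j , eq = chain-surjective (top-leads v-act lt) v-act (⊑-top v-act)
      in inj₁ (i , inj₁ j) , eq
    ... | tri> _ _ gt =
      let σv-act = σ-active v-act
          gt′ = subst (λ w → top (σ v) Fin.< top w) (≡.sym (σ-involutive v-act)) gt
          i , j , eq = chain-surjective (top-leads σv-act gt′) σv-act (⊑-top σv-act)
      in inj₁ (i , inj₂ j) , ≡.trans (cong σ eq) (σ-involutive v-act)

    G≅K : graph ≅ K
    G≅K = record
      { bijection = mk↔ₛ′ code vertex (λ x → vertex-injective _ x (vertex-code (vertex x))) vertex-code
      ; adjacency = λ u v → subst₂ (λ u′ v′ → Adj u′ v′ ⇔ Graph.Adj K (code u) (code v))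
          (vertex-code u) (vertex-code v) (vertex-adj (code u) (code v))
      }
      where
      code : Fin n → Graph.Vertex K
      code = proj₁ ∘ vertex-surjective
      vertex-code : ∀ v → vertex (code v) ≡ v
      vertex-code = proj₂ ∘ vertex-surjective

    -- Ensures that there is at least one half-graph.
    active⇒piece : ∀ {v} → Active v → Fin Pieces.size
    active⇒piece {v} v-act with vertex-surjective v
    ... | inj₁ (i , _) , _  = i
    ... | inj₂ r , refl     = contradiction (Remainder.sound r) v-act

    halfGraphsAndIsolated : ∃ Active → ∃ (Isolated graph) → HalfGraphsAndIsolatedSet graph
    halfGraphsAndIsolated (v , v-act) (z , z-iso) =
        Pieces.size , Fin.nonZeroIndex (active⇒piece v-act)
      , pieces , (λ i → order i , halfGraph-isHalfGraph (order i) {{ℕ.>-nonZero (active⇒deg>0 (apex-active i))}})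
      , remainder , (proj₁ (Remainder.complete z z-iso) , λ _ _ ())
      , G≅K

theorem5p7 : (n : ℕ) .{{_ : NonZero n}} (G : FiniteGraph n) → FiniteGraph.Loopless G →
    WellGraded (neighbourhoodSystem G) ⇔
    (NonemptyIsolatedSet (FiniteGraph.graph G) ⊎ HalfGraphsAndIsolatedSet (FiniteGraph.graph G))
theorem5p7 (suc m) G loopless = mk⇔ decompose assemble
  where
  open FiniteGraph G
  open Finite G
  open OneInclusion G

  decompose : WellGraded 𝓕 → NonemptyIsolatedSet graph ⊎ HalfGraphsAndIsolatedSet graph
  decompose wg with wellGraded⇒peeling×isolated loopless wg | Fin.all? isolated?
  ... | _ | yes all-isolated = inj₁ (zero , all-isolated)
  ... | P , z | no ¬all = inj₂ (Decomposition.halfGraphsAndIsolated G loopless P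
    (enumerate (Decomposition.leading? G loopless P)) (enumerate isolated?)
    (Fin.¬∀⟶∃¬ (suc m) _ isolated? ¬all) z)

  assemble : NonemptyIsolatedSet graph ⊎ HalfGraphsAndIsolatedSet graph → WellGraded 𝓕
  assemble (inj₁ (_ , all-isolated)) = peeling⇒wellGraded (edgeless-peeling all-isolated)
  assemble (inj₂ halves)             = peeling⇒wellGraded (halfGraphs⇒peeling halves)
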